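{- For all $n$, $\mathrm{Sort}_n(132,321)=\mathrm{Av}_n(123,132^{\star})$.
   Context: $\mathrm{Av}_n(123,132^{\star})$ is the set of $x\in S_n$ that avoid the classical pattern $123$ (no subsequence order-isomorphic to $123$) and the bivincular pattern $132^{\star}$, where an occurrence of $132^{\star}$ in $x=x_1\cdots x_n$ is a pair of indices $a<b<n$ with $x_a<x_{b+1}$ and $x_b=x_{b+1}+1$. For a set $T$ of patterns, the map $s_T$ is defined as follows: the entries of the input permutation are read from left to right, with an initially empty stack. At each step, if the input is nonempty and pushing the next input entry onto the stack produces a stack whose contents, read from top to bottom, avoid every pattern in $T$, that entry is pushed; otherwise the top entry of the stack is popped and appended to the output. When the input is exhausted, the remaining stack entries are popped one at a time to the output. Write $s_{\sigma,\tau}=s_{\{\sigma,\tau\}}$ and $s=s_{\{21\}}$ (West's stack-sorting map). $\mathrm{Sort}_n(\sigma,\tau)$ is the set of $x\in S_n$ with $s(s_{\sigma,\tau}(x))=12\cdots n$. -}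

module Defs where

open import Data.Bool using (if_then_else_)
open import Data.Nat using (ℕ; suc; _<_)
open import Data.Nat.Properties using (_<?_) renaming (_≟_ to _≟ℕ_)
open import Data.Fin as Fin using (Fin; toℕ; cast)
open import Data.Fin.Properties using (all?)
open import Data.List using (List; []; _∷_; length; lookup; applyUpTo)
open import Data.List.Relation.Unary.All as All using (All)
open import Data.List.Relation.Binary.Sublist.Propositional using (_⊆_; []; _∷_; _∷ʳ_)
open import Data.List.Relation.Binary.Permutation.Propositional using (_↭_)
open import Data.Product using (Σ; ∃; _×_; _,_)
open import Data.Sum using (inj₁; inj₂; [_,_])
open import Function using (_∘_)
open import Function.Bundles using (_⇔_; mk⇔; Equivalence)
open import Level using (0ℓ)
open import Relation.Binary.PropositionalEquality using (_≡_; refl)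
open import Relation.Nullary using (¬_; Dec; does; yes; no; ¬?)
open import Relation.Nullary.Decidable using (map′; _⊎-dec_; _→-dec_; _×-dec_)
open import Relation.Unary using (Pred; Decidable)

-- Permutations are in one-line notation x₁ ∷ … ∷ xₙ ∷ [], with values 1, …, n.
Word : Set
Word = List ℕ

identity : ℕ → Word
identity n = applyUpTo suc n

S : ℕ → Pred Word 0ℓ
S n x = x ↭ identity n

OrderIsomorphic : Word → Word → Set
OrderIsomorphic u v =
  Σ (length u ≡ length v) λ eq →
    ∀ (i j : Fin (length u)) →
      (lookup u i < lookup u j) ⇔ (lookup v (cast eq i) < lookup v (cast eq j))

Contains : Word → Word → Set
Contains p x = ∃ λ u → u ⊆ x × OrderIsomorphic u p

Avoids : Word → Word → Set
Avoids p x = ¬ Contains p x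

private
  _⇔-dec_ : ∀ {A B : Set} → Dec A → Dec B → Dec (A ⇔ B)
  a? ⇔-dec b? =
    map′ (λ (f , g) → mk⇔ f g) (λ e → Equivalence.to e , Equivalence.from e)
         ((a? →-dec b?) ×-dec (b? →-dec a?))

  anySublist? : ∀ {P : Pred Word 0ℓ} → Decidable P →
                ∀ x → Dec (∃ λ u → u ⊆ x × P u)
  anySublist? P? [] = map′ (λ p → [] , [] , p) (λ { (_ , [] , p) → p }) (P? [])
  anySublist? P? (x ∷ xs) =
    map′ [ (λ (u , s , p) → u , x ∷ʳ s , p)
         , (λ (u , s , p) → x ∷ u , refl ∷ s , p) ]
         (λ { (u , _ ∷ʳ s , p) → inj₁ (u , s , p)
            ; (_ ∷ u , refl ∷ s , p) → inj₂ (u , s , p) })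
         (anySublist? P? xs ⊎-dec anySublist? (P? ∘ (x ∷_)) xs)

orderIsomorphic? : ∀ u v → Dec (OrderIsomorphic u v)
orderIsomorphic? u v with length u ≟ℕ length v
... | no  neq = no λ (eq , _) → neq eq
... | yes eq  =
  map′ (eq ,_) (λ (_ , h) → h)
       (all? λ i → all? λ j →
         (lookup u i <? lookup u j)
           ⇔-dec (lookup v (cast eq i) <? lookup v (cast eq j)))

contains? : ∀ p x → Dec (Contains p x)
contains? p = anySublist? (λ u → orderIsomorphic? u p)

AvoidsAll : List Word → Word → Set
AvoidsAll T x = All (λ p → Avoids p x) T

avoidsAll? : ∀ T x → Dec (AvoidsAll T x)
avoidsAll? T x = All.all? (λ p → ¬? (contains? p x)) T

-- run T input stack is the remaining output; the head of the stack list is its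
-- top.  With an empty stack there is nothing to pop, so the entry is pushed
-- unconditionally; a one-entry stack avoids every pattern of length ≥ 2, so for
-- such T this agrees with the avoidance test.
run : List Word → Word → Word → Word
run T []          stack       = stack
run T (x ∷ input) []          = run T input (x ∷ [])
run T (x ∷ input) (t ∷ stack) =
  if does (avoidsAll? T (x ∷ t ∷ stack))
  then run T input (x ∷ t ∷ stack)
  else t ∷ run T (x ∷ input) stack

stackMap : List Word → Word → Word
stackMap T x = run T x []

s[_,_] : Word → Word → Word → Word
s[ σ , τ ] = stackMap (σ ∷ τ ∷ [])

s : Word → Word
s = stackMap ((2 ∷ 1 ∷ []) ∷ [])

Sort : ℕ → Word → Word → Pred Word 0ℓ
Sort n σ τ x = S n x × s (s[ σ , τ ] x) ≡ identity n

123ₚ 132ₚ 321ₚ : Word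
123ₚ = 1 ∷ 2 ∷ 3 ∷ []
132ₚ = 1 ∷ 3 ∷ 2 ∷ []
321ₚ = 3 ∷ 2 ∷ 1 ∷ []

-- c plays the role of b + 1; its being an index of x encodes b < n.
Contains132⋆ : Word → Set
Contains132⋆ x =
  ∃ λ (a : Fin (length x)) → ∃ λ (b : Fin (length x)) → ∃ λ (c : Fin (length x)) →
    a Fin.< b × toℕ c ≡ suc (toℕ b) ×
    lookup x a < lookup x c × lookup x b ≡ suc (lookup x c)

Av[123,132⋆] : ℕ → Pred Word 0ℓ
Av[123,132⋆] n x = S n x × Avoids 123ₚ x × ¬ Contains132⋆ x

{-# OPTIONS --safe #-}

-- As long as s[ 132ₚ , 321ₚ ] holds at most one entry y above the left-to-right minima of
-- the input read so far, those minima lie on the stack in increasing order, and a further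
-- non-minimum z can be pushed onto y only if z < y and no minimum lies strictly between.
-- The minima leave last, in increasing order, so the output is W followed by the minima,
-- and West's map sorts it iff W is decreasing, the smallest entry coming after all of W.
-- Two entries above the minima are popped in increasing order, so this forbids any such
-- push; then W lists the non-minima in input order, and they decrease iff x avoids 123.
-- For x avoiding 123, such a push is exactly an occurrence of 132⋆.
module Submission where

open import Defs
open import Data.Bool using (if_then_else_)
open import Data.Empty using (⊥; ⊥-elim)
open import Data.Fin as Fin using (Fin; zero; suc; toℕ)
open import Data.List using (List; []; _∷_; _++_; _ʳ++_; length; lookup; reverse)
open import Data.List.Membership.Propositional using (_∈_; find)
open import Data.List.Membership.Propositional.Properties using (∈-++⁺ʳ; ∈-++⁻; ∈-applyUpTo⁺; ∈-applyUpTo⁻)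
open import Data.List.Properties using (++-identityʳ; ++-ʳ++; ʳ++-ʳ++; ʳ++-defn; reverse-involutive)
open import Data.List.Relation.Binary.Permutation.Propositional using (_↭_; ↭-refl; ↭-sym; ↭-trans; prep; ↭⇒↭ₛ)
open import Data.List.Relation.Binary.Permutation.Propositional.Properties using (All-resp-↭; Any-resp-↭; ∈-resp-↭; shift; ++-comm; ++↭ʳ++; ↭-reverse)
import Data.List.Relation.Binary.Permutation.Setoid.Properties as Permutationₛ
open import Data.List.Relation.Binary.Pointwise using (Pointwise-≡⇒≡)
open import Data.List.Relation.Binary.Sublist.Propositional using (_⊆_; []; _∷_; _∷ʳ_; ⊆-refl; ⊆-trans; minimum; from∈; to∈)
open import Data.List.Relation.Binary.Sublist.Propositional.Properties using (All-resp-⊆; Any-resp-⊆; ∷⁻; ʳ++⁺; reverse⁺; ++⁺ˡ)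
open import Data.List.Relation.Unary.All as All using (All; []; _∷_)
import Data.List.Relation.Unary.All.Properties as All
open import Data.List.Relation.Unary.AllPairs as AllPairs using (AllPairs; []; _∷_)
import Data.List.Relation.Unary.AllPairs.Properties as AllPairs
open import Data.List.Relation.Unary.Any as Any using (Any; here; there; any?)
open import Data.List.Relation.Unary.Sorted.TotalOrder.Properties using (AllPairs⇒Sorted; ↗↭↗⇒≋)
open import Data.List.Relation.Unary.Unique.Propositional using (Unique)
open import Data.Nat using (ℕ; suc; _≤_; _<_; s≤s; z<s; s<s)
open import Data.Nat.Properties
open import Data.Product using (∃; ∃₂; _×_; _,_)
open import Data.Sum using (_⊎_; inj₁; inj₂; [_,_]′)
open import Function using (_∘_; _⇔_; mk⇔; case_of_)
open import Function.Bundles using (Equivalence)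
open import Level using (0ℓ)
open import Relation.Binary.Core using (Rel)
open import Relation.Binary.Definitions using (tri<; tri≈; tri>)
open import Relation.Binary.PropositionalEquality using (_≡_; _≢_; refl; sym; trans; cong; subst; setoid)
open import Relation.Nullary using (¬_; Dec; yes; no)
open import Relation.Nullary.Decidable using (dec-true; dec-false; _×-dec_; _⊎-dec_)
open import Relation.Unary using (_≐_)

-- Sublists, sorted words and permutations

AllPairs-resp-⊆ : ∀ {R : Rel ℕ 0ℓ} {xs ys} → xs ⊆ ys → AllPairs R ys → AllPairs R xs
AllPairs-resp-⊆ []         []       = []
AllPairs-resp-⊆ (_ ∷ʳ τ)   (_ ∷ rs) = AllPairs-resp-⊆ τ rs
AllPairs-resp-⊆ (refl ∷ τ) (r ∷ rs) = All-resp-⊆ τ r ∷ AllPairs-resp-⊆ τ rs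

⊆-ʳ++ : ∀ (xs : Word) {ys} → ys ⊆ xs ʳ++ ys
⊆-ʳ++ []       = ⊆-refl
⊆-ʳ++ (x ∷ xs) = ⊆-trans (x ∷ʳ ⊆-refl) (⊆-ʳ++ xs)

Sorted : Word → Set
Sorted = AllPairs _≤_

ascending : ∀ {xs a b} → Sorted xs → a ∷ b ∷ [] ⊆ xs → a ≤ b
ascending xs↗ τ with (a≤b ∷ []) ∷ _ ← AllPairs-resp-⊆ τ xs↗ = a≤b

identity-sorted : ∀ n → Sorted (identity n)
identity-sorted n = AllPairs.applyUpTo⁺₁ suc n (λ i<j _ → s≤s (<⇒≤ i<j))

sorted-↭⇒≡ : ∀ {xs ys} → Sorted xs → Sorted ys → xs ↭ ys → xs ≡ ys
sorted-↭⇒≡ xs↗ ys↗ xs↭ys = Pointwise-≡⇒≡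
  (↗↭↗⇒≋ ≤-totalOrder (AllPairs⇒Sorted ≤-totalOrder xs↗) (AllPairs⇒Sorted ≤-totalOrder ys↗) (↭⇒↭ₛ xs↭ys))

permutation-unique : ∀ {n x} → S n x → Unique x
permutation-unique {n} x↭id = Permutationₛ.Unique-resp-↭ (setoid ℕ) (↭⇒↭ₛ (↭-sym x↭id))
  (AllPairs.applyUpTo⁺₁ suc n (λ i<j _ → <⇒≢ (s<s i<j)))

reverse-∈S : ∀ {n x} → S n x → S n (reverse x)
reverse-∈S {x = x} x∈S = ↭-trans (↭-reverse x) x∈S

-- Pattern containment

-- Settles both ordered pairs of two distinct positions at once, so a three-letter pattern needs
-- three comparisons.
SameOrder : ℕ → ℕ → ℕ → ℕ → Set
SameOrder a b a′ b′ = (a < b × a′ < b′) ⊎ (b < a × b′ < a′)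

sameOrder⇒⇔ : ∀ {a b a′ b′} → SameOrder a b a′ b′ → (a < b) ⇔ (a′ < b′)
sameOrder⇒⇔ (inj₁ (a<b , a′<b′)) = mk⇔ (λ _ → a′<b′) (λ _ → a<b)
sameOrder⇒⇔ (inj₂ (b<a , b′<a′)) = mk⇔ (⊥-elim ∘ <-asym b<a) (⊥-elim ∘ <-asym b′<a′)

sameOrder-sym : ∀ {a b a′ b′} → SameOrder a b a′ b′ → SameOrder b a b′ a′
sameOrder-sym (inj₁ p) = inj₂ p
sameOrder-sym (inj₂ p) = inj₁ p

irrefl⇔ : ∀ {a a′} → (a < a) ⇔ (a′ < a′)
irrefl⇔ = mk⇔ (⊥-elim ∘ <-irrefl refl) (⊥-elim ∘ <-irrefl refl)

orderIsomorphic₂ : ∀ {a b a′ b′} → SameOrder a b a′ b′ →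
                   OrderIsomorphic (a ∷ b ∷ []) (a′ ∷ b′ ∷ [])
orderIsomorphic₂ ab = refl , λ where
  zero       zero       → irrefl⇔
  zero       (suc zero) → sameOrder⇒⇔ ab
  (suc zero) zero       → sameOrder⇒⇔ (sameOrder-sym ab)
  (suc zero) (suc zero) → irrefl⇔

orderIsomorphic₃ : ∀ {a b c a′ b′ c′} →
                   SameOrder a b a′ b′ → SameOrder a c a′ c′ → SameOrder b c b′ c′ →
                   OrderIsomorphic (a ∷ b ∷ c ∷ []) (a′ ∷ b′ ∷ c′ ∷ [])
orderIsomorphic₃ ab ac bc = refl , λ where
  zero             zero             → irrefl⇔
  zero             (suc zero)       → sameOrder⇒⇔ ab
  zero             (suc (suc zero)) → sameOrder⇒⇔ ac
  (suc zero)       zero             → sameOrder⇒⇔ (sameOrder-sym ab)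
  (suc zero)       (suc zero)       → irrefl⇔
  (suc zero)       (suc (suc zero)) → sameOrder⇒⇔ bc
  (suc (suc zero)) zero             → sameOrder⇒⇔ (sameOrder-sym ac)
  (suc (suc zero)) (suc zero)       → sameOrder⇒⇔ (sameOrder-sym bc)
  (suc (suc zero)) (suc (suc zero)) → irrefl⇔

1<2 : 1 < 2
1<2 = s<s z<s

2<3 : 2 < 3
2<3 = s<s 1<2

1<3 : 1 < 3
1<3 = s<s z<s

21ₚ : Word
21ₚ = 2 ∷ 1 ∷ []

contains-21⁺ : ∀ {a b w} → b ∷ a ∷ [] ⊆ w → a < b → Contains 21ₚ w
contains-21⁺ τ a<b = _ , τ , orderIsomorphic₂ (inj₂ (a<b , 1<2))

contains-21⁻ : ∀ {w} → Contains 21ₚ w → ∃₂ λ a b → b ∷ a ∷ [] ⊆ w × a < b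
contains-21⁻ (b ∷ a ∷ [] , τ , _ , iso) =
  a , b , τ , Equivalence.from (iso (suc zero) zero) 1<2

contains-123⁺ : ∀ {a b c w} → a ∷ b ∷ c ∷ [] ⊆ w → a < b → b < c → Contains 123ₚ w
contains-123⁺ τ a<b b<c = _ , τ ,
  orderIsomorphic₃ (inj₁ (a<b , 1<2)) (inj₁ (<-trans a<b b<c , 1<3)) (inj₁ (b<c , 2<3))

contains-123⁻ : ∀ {w} → Contains 123ₚ w →
                ∃ λ a → ∃₂ λ b c → a ∷ b ∷ c ∷ [] ⊆ w × a < b × b < c
contains-123⁻ (a ∷ b ∷ c ∷ [] , τ , _ , iso) = a , b , c , τ ,
  Equivalence.from (iso zero (suc zero)) 1<2 ,
  Equivalence.from (iso (suc zero) (suc (suc zero))) 2<3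

contains-132⁺ : ∀ {a b c w} → a ∷ c ∷ b ∷ [] ⊆ w → a < b → b < c → Contains 132ₚ w
contains-132⁺ τ a<b b<c = _ , τ ,
  orderIsomorphic₃ (inj₁ (<-trans a<b b<c , 1<3)) (inj₁ (a<b , 1<2)) (inj₂ (b<c , 2<3))

contains-132⁻ : ∀ {w} → Contains 132ₚ w →
                ∃ λ a → ∃₂ λ b c → a ∷ c ∷ b ∷ [] ⊆ w × a < b × b < c
contains-132⁻ (a ∷ c ∷ b ∷ [] , τ , _ , iso) = a , b , c , τ ,
  Equivalence.from (iso zero (suc (suc zero))) 1<2 ,
  Equivalence.from (iso (suc (suc zero)) (suc zero)) 2<3

contains-321⁺ : ∀ {a b c w} → c ∷ b ∷ a ∷ [] ⊆ w → a < b → b < c → Contains 321ₚ w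
contains-321⁺ τ a<b b<c = _ , τ ,
  orderIsomorphic₃ (inj₂ (b<c , 2<3)) (inj₂ (<-trans a<b b<c , 1<3)) (inj₂ (a<b , 1<2))

contains-321⁻ : ∀ {w} → Contains 321ₚ w →
                ∃ λ a → ∃₂ λ b c → c ∷ b ∷ a ∷ [] ⊆ w × a < b × b < c
contains-321⁻ (c ∷ b ∷ a ∷ [] , τ , _ , iso) = a , b , c , τ ,
  Equivalence.from (iso (suc (suc zero)) (suc zero)) 1<2 ,
  Equivalence.from (iso (suc zero) zero) 2<3

avoids-21⇒sorted : ∀ {w} → Avoids 21ₚ w → Sorted w
avoids-21⇒sorted {[]}    _  = []
avoids-21⇒sorted {a ∷ w} av =
  All.tabulate (λ b∈w → ≮⇒≥ (av ∘ contains-21⁺ (refl ∷ from∈ b∈w))) ∷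
  avoids-21⇒sorted (λ (u , τ , iso) → av (u , a ∷ʳ τ , iso))

sorted⇒avoids-21 : ∀ {w} → Sorted w → Avoids 21ₚ w
sorted⇒avoids-21 w↗ c with _ , _ , τ , a<b ← contains-21⁻ c = <⇒≱ a<b (ascending w↗ τ)

-- Stack machines

run-push : ∀ T {z t st} inp → AvoidsAll T (z ∷ t ∷ st) →
           run T (z ∷ inp) (t ∷ st) ≡ run T inp (z ∷ t ∷ st)
run-push T {z} {t} {st} inp av =
  cong (λ b → if b then run T inp (z ∷ t ∷ st) else t ∷ run T (z ∷ inp) st)
       (dec-true (avoidsAll? T (z ∷ t ∷ st)) av)

run-pop : ∀ T {z t st} inp → ¬ AvoidsAll T (z ∷ t ∷ st) →
          run T (z ∷ inp) (t ∷ st) ≡ t ∷ run T (z ∷ inp) st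
run-pop T {z} {t} {st} inp ¬av =
  cong (λ b → if b then run T inp (z ∷ t ∷ st) else t ∷ run T (z ∷ inp) st)
       (dec-false (avoidsAll? T (z ∷ t ∷ st)) ¬av)

run-step : ∀ T z inp t st →
           (AvoidsAll T (z ∷ t ∷ st) × run T (z ∷ inp) (t ∷ st) ≡ run T inp (z ∷ t ∷ st)) ⊎
           (¬ AvoidsAll T (z ∷ t ∷ st) × run T (z ∷ inp) (t ∷ st) ≡ t ∷ run T (z ∷ inp) st)
run-step T z inp t st with avoidsAll? T (z ∷ t ∷ st)
... | yes av = inj₁ (av , refl)
... | no ¬av = inj₂ (¬av , refl)

run-↭ : ∀ T inp st → run T inp st ↭ inp ++ st
run-↭ T []        st       = ↭-refl
run-↭ T (z ∷ inp) []       = ↭-trans (run-↭ T inp (z ∷ [])) (shift z inp [])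
run-↭ T (z ∷ inp) (t ∷ st) =
  [ (λ (_ , eq) → subst (_↭ z ∷ inp ++ t ∷ st) (sym eq)
      (↭-trans (run-↭ T inp (z ∷ t ∷ st)) (shift z inp (t ∷ st))))
  , (λ (_ , eq) → subst (_↭ z ∷ inp ++ t ∷ st) (sym eq)
      (↭-trans (prep t (run-↭ T (z ∷ inp) st)) (↭-sym (shift t (z ∷ inp) st))))
  ]′ (run-step T z inp t st)

stackMap-↭ : ∀ T x → stackMap T x ↭ x
stackMap-↭ T x = subst (stackMap T x ↭_) (++-identityʳ x) (run-↭ T x [])

-- West's map on a word M ʳ++ T whose final run T is increasing

West : List Word
West = 21ₚ ∷ []

-- On an increasing input West's machine merges: an entry `z < t` can always be pushed on the
-- increasing stack, so a pop means `t ≤ z`, and then `t` is at most everything left.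
west-merge : ∀ inp st → Sorted inp → Sorted st → Sorted (run West inp st)
west-merge []        st       _            st↗ = st↗
west-merge (z ∷ inp) []       (_ ∷ inp↗)   _   = west-merge inp (z ∷ []) inp↗ ([] ∷ [])
west-merge (z ∷ inp) (t ∷ st) inp↗@(z≤ ∷ inp↗′) st↗@(t≤ ∷ st↗′) =
  [ (λ (av , eq) → subst Sorted (sym eq)
      (west-merge inp (z ∷ t ∷ st) inp↗′ (avoids-21⇒sorted (All.head av))))
  , (λ (¬av , eq) → subst Sorted (sym eq)
      (All-resp-↭ (↭-sym (run-↭ West (z ∷ inp) st))
        (All.++⁺ (t≤z ¬av ∷ All.map (≤-trans (t≤z ¬av)) z≤) t≤) ∷
       west-merge (z ∷ inp) st inp↗ st↗′))
  ]′ (run-step West z inp t st)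
  where
  t≤z : ¬ AvoidsAll West (z ∷ t ∷ st) → t ≤ z
  t≤z ¬av = ≮⇒≥ λ z<t → ¬av (sorted⇒avoids-21
    ((<⇒≤ z<t ∷ All.map (≤-trans (<⇒≤ z<t)) t≤) ∷ st↗) ∷ [])

-- Every intermediate stack is a suffix of `W ʳ++ st`, hence increasing, so no push is refused.
west-push-all : ∀ W st {inp} → Sorted (W ʳ++ st) → run West (W ++ inp) st ≡ run West inp (W ʳ++ st)
west-push-all []      st       _ = refl
west-push-all (w ∷ W) []       h = west-push-all W (w ∷ []) h
west-push-all (w ∷ W) (t ∷ st) {inp} h = trans
  (run-push West (W ++ inp) (sorted⇒avoids-21 (AllPairs-resp-⊆ (⊆-ʳ++ W) h) ∷ []))
  (west-push-all W (w ∷ t ∷ st) h)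

-- An entry popped before a is read would precede the smaller a in the output.
west-sorted⇒ : ∀ W st {a inp} → All (a <_) W → All (a <_) st → Sorted st →
               Sorted (run West (W ++ a ∷ inp) st) → Sorted (W ʳ++ st)
west-sorted⇒ []      st       _          _          st↗ _   = st↗
west-sorted⇒ (w ∷ W) []       (a<w ∷ a<W) _         _   out↗ =
  west-sorted⇒ W (w ∷ []) a<W (a<w ∷ []) ([] ∷ []) out↗
west-sorted⇒ (w ∷ W) (t ∷ st) {a} {inp} (a<w ∷ a<W) (a<t ∷ a<st) st↗ out↗ with avoidsAll? West (w ∷ t ∷ st)
... | yes av@(av₁ ∷ []) = west-sorted⇒ W (w ∷ t ∷ st) a<W (a<w ∷ a<t ∷ a<st) (avoids-21⇒sorted av₁)
                            (subst Sorted (run-push West (W ++ a ∷ inp) av) out↗)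
... | no ¬av with t≤ ∷ _ ← subst Sorted (run-pop West (W ++ a ∷ inp) ¬av) out↗ =
  ⊥-elim (<⇒≱ a<t (All.lookup (All-resp-↭ (run-↭ West (w ∷ W ++ a ∷ inp) st) t≤) a∈))
  where
  a∈ : a ∈ w ∷ (W ++ a ∷ inp) ++ st
  a∈ = there (∈-resp-↭ (++-comm st (W ++ a ∷ inp)) (∈-++⁺ʳ st (∈-++⁺ʳ W (here refl))))

-- The decreasing word `reverse M` is pushed entirely, which leaves `M` on the stack; `T` is then
-- merged into it.
west-sorts : ∀ M T → Sorted M → Sorted T → Sorted (s (M ʳ++ T))
west-sorts M T M↗ T↗ = subst Sorted
  (sym (trans (cong s (ʳ++-defn M)) (west-push-all (reverse M) [] reverse²↗)))
  (west-merge T (reverse M ʳ++ []) T↗ reverse²↗)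
  where
  reverse²↗ : Sorted (reverse (reverse M))
  reverse²↗ = subst Sorted (sym (reverse-involutive M)) M↗

-- The entry `t` acts as a sentinel: all of `reverse M` must still be on the stack when it is read.
west-sorts⁻ : ∀ M {t T} → All (t <_) M → Sorted (s (M ʳ++ (t ∷ T))) → Sorted M
west-sorts⁻ M t<M out↗ = subst Sorted (reverse-involutive M)
  (west-sorted⇒ (reverse M) [] (All-resp-↭ (↭-sym (↭-reverse M)) t<M) [] []
    (subst (Sorted ∘ s) (ʳ++-defn M) out↗))

-- The stack of s[ 132ₚ , 321ₚ ]

Patterns : List Word
Patterns = 132ₚ ∷ 321ₚ ∷ []

-- Both patterns end in a descent, which would have to lie in the increasing stack below `z`.
push-on-sorted : ∀ z {st} → Sorted st → AvoidsAll Patterns (z ∷ st)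
push-on-sorted z st↗ =
  (λ c → let _ , _ , _ , τ , _ , b<c = contains-132⁻ c in <⇒≱ b<c (ascending st↗ (∷⁻ τ))) ∷
  (λ c → let _ , _ , _ , τ , a<b , _ = contains-321⁻ c in <⇒≱ a<b (ascending st↗ (∷⁻ τ))) ∷ []

-- The two ways in which `z` above `y` completes a pattern: `y < z` gives 321 together with a
-- minimum below `y`, and `z`, `y`, `v` is an occurrence of 132.
Blocked : ℕ → ℕ → Word → Set
Blocked z y T = y < z ⊎ Any (λ v → z < v × v < y) T

blocked? : ∀ z y T → Dec (Blocked z y T)
blocked? z y T = (y <? z) ⊎-dec any? (λ v → (z <? v) ×-dec (v <? y)) T

-- An occurrence that uses both `z` and `y` makes `z` blocked; any other has its final descent
-- inside `T`.
push-unblocked : ∀ {z y T} → Sorted T → ¬ Blocked z y T → AvoidsAll Patterns (z ∷ y ∷ T)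
push-unblocked {z} {y} {T} T↗ ¬bl = no132 ∷ no321 ∷ []
  where
  no132 : Avoids 132ₚ (z ∷ y ∷ T)
  no132 c with contains-132⁻ c
  ... | _ , _ , _ , refl ∷ refl ∷ τ , a<b , b<c =
    ¬bl (inj₂ (Any.map (λ { refl → a<b , b<c }) (to∈ τ)))
  ... | _ , _ , _ , refl ∷ _ ∷ʳ τ , _ , b<c = <⇒≱ b<c (ascending T↗ τ)
  ... | _ , _ , _ , _ ∷ʳ τ , _ , b<c = <⇒≱ b<c (ascending T↗ (∷⁻ τ))

  no321 : Avoids 321ₚ (z ∷ y ∷ T)
  no321 c with contains-321⁻ c
  ... | _ , _ , _ , refl ∷ refl ∷ _ , _ , b<c = ¬bl (inj₁ b<c)
  ... | _ , _ , _ , refl ∷ _ ∷ʳ τ , a<b , _ = <⇒≱ a<b (ascending T↗ τ)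
  ... | _ , _ , _ , _ ∷ʳ τ , a<b , _ = <⇒≱ a<b (ascending T↗ (∷⁻ τ))

no-push-blocked : ∀ {z y t T} → t < y → Blocked z y (t ∷ T) → ¬ AvoidsAll Patterns (z ∷ y ∷ t ∷ T)
no-push-blocked t<y (inj₁ y<z) (_ ∷ av ∷ []) = av (contains-321⁺ (refl ∷ refl ∷ refl ∷ minimum _) t<y y<z)
no-push-blocked t<y (inj₂ between) (av ∷ _) with _ , v∈ , z<v , v<y ← find between =
  av (contains-132⁺ (refl ∷ refl ∷ from∈ v∈) z<v v<y)

≢⇒<⊎> : ∀ {m n} → m ≢ n → m < n ⊎ n < m
≢⇒<⊎> {m} {n} m≢n with <-cmp m n
... | tri< m<n _ _ = inj₁ m<n
... | tri≈ _ m≡n _ = ⊥-elim (m≢n m≡n)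
... | tri> _ _ n<m = inj₂ n<m

-- Entries already read are listed latest first in `p`, and `inp` is still to come, so the word is
-- kept in reversed form.
head-≢ : ∀ inp {z p v} → Unique (inp ʳ++ (z ∷ p)) → v ∈ p → z ≢ v
head-≢ inp u v∈p with z≢ ∷ _ ← AllPairs-resp-⊆ (⊆-ʳ++ inp) u = All.lookup z≢ v∈p

sorted-∷ : ∀ {z t T} → z < t → Sorted (t ∷ T) → Sorted (z ∷ t ∷ T)
sorted-∷ z<t T↗@(t≤ ∷ _) = (<⇒≤ z<t ∷ All.map (≤-trans (<⇒≤ z<t)) t≤) ∷ T↗

-- M lists the output before the minima, latest entry first.
Spill : Word → Word → Set
Spill L out = ∃ λ M → ∃₂ λ t T → out ≡ M ʳ++ (t ∷ T) × All (t <_) M × L ⊆ M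

-- The minima stay at the bottom until the input ends: a new minimum `z` above a pending `y` would
-- form 132 as `z`, `y`, `t`, so all of `Y` is popped first. Whatever is pushed later, the entries
-- of `Y` leave top first, after those of `N`, which is all that `L ⊆ M` records.
spill : ∀ inp Y N t T → Unique (inp ʳ++ (t ∷ T)) → Sorted (t ∷ T) → All (t <_) Y → All (t <_) N →
        Spill (Y ʳ++ N) (N ʳ++ run Patterns inp (Y ++ t ∷ T))
spill [] Y N t T _ _ t<Y t<N =
  Y ʳ++ N , t , T , sym (ʳ++-ʳ++ Y) , All-resp-↭ (++↭ʳ++ Y N) (All.++⁺ t<Y t<N) , ⊆-refl
spill (z ∷ inp) [] N t T u T↗ _ t<N =
  subst (λ o → Spill N (N ʳ++ o)) (sym (run-push Patterns inp (push-on-sorted z T↗)))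
    ([ (λ z<t → spill inp [] N z (t ∷ T) u (sorted-∷ z<t T↗) [] (All.map (<-trans z<t) t<N))
     , (λ t<z → let M , t′ , T′ , eq , t′<M , L⊆M =
                      spill inp (z ∷ []) N t T
                        (AllPairs-resp-⊆ (ʳ++⁺ {as = inp} ⊆-refl (z ∷ʳ ⊆-refl)) u) T↗ (t<z ∷ []) t<N
                in M , t′ , T′ , eq , t′<M , ⊆-trans (z ∷ʳ ⊆-refl) L⊆M)
     ]′ (≢⇒<⊎> (head-≢ inp u (here refl))))
spill (z ∷ inp) (y ∷ Y) N t T u T↗ (t<y ∷ t<Y) t<N =
  [ (λ (av , eq) → subst (λ o → Spill (Y ʳ++ (y ∷ N)) (N ʳ++ o)) (sym eq)
      (let M , t′ , T′ , eq′ , t′<M , L⊆M =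
             spill inp (z ∷ y ∷ Y) N t T
               (AllPairs-resp-⊆ (ʳ++⁺ {as = inp} ⊆-refl (z ∷ʳ ⊆-refl)) u) T↗ (t<z av ∷ t<y ∷ t<Y) t<N
       in M , t′ , T′ , eq′ , t′<M , ⊆-trans (ʳ++⁺ {as = y ∷ Y} ⊆-refl (z ∷ʳ ⊆-refl)) L⊆M))
  , (λ (_ , eq) → subst (λ o → Spill (Y ʳ++ (y ∷ N)) (N ʳ++ o)) (sym eq)
      (spill (z ∷ inp) Y (y ∷ N) t T u T↗ t<Y (t<y ∷ t<N)))
  ]′ (run-step Patterns z inp y (Y ++ t ∷ T))
  where
  t<z : AvoidsAll Patterns (z ∷ y ∷ Y ++ t ∷ T) → t < z
  t<z (av ∷ _) with ≢⇒<⊎> (head-≢ inp u (here refl))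
  ... | inj₁ z<t = ⊥-elim (av (contains-132⁺ (refl ∷ refl ∷ ++⁺ˡ Y (refl ∷ minimum T)) z<t t<y))
  ... | inj₂ t<z = t<z

-- States with at most one entry above the left-to-right minima

-- Reach p Y N T: after reading the reverse of p, T holds the left-to-right minima,
-- at most one entry Y lies above them, and N are the popped entries, latest first.
data Reach : (p Y N T : Word) → Set where
  first   : ∀ {z} → Reach (z ∷ []) [] [] (z ∷ [])
  lrMin   : ∀ {z p Y N t T} → Reach p Y N (t ∷ T) → z < t →
            Reach (z ∷ p) [] (Y ++ N) (z ∷ t ∷ T)
  nonMin  : ∀ {z p Y N t T} → Reach p Y N (t ∷ T) → t < z → All (λ y → Blocked z y (t ∷ T)) Y →
            Reach (z ∷ p) (z ∷ []) (Y ++ N) (t ∷ T)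

reach-pending : ∀ {p Y N T} → Reach p Y N T → Y ≡ [] ⊎ ∃ λ y → Y ≡ y ∷ []
reach-pending first          = inj₁ refl
reach-pending (lrMin _ _)    = inj₁ refl
reach-pending (nonMin _ _ _) = inj₂ (_ , refl)

reach-mins-⊆ : ∀ {p Y N T} → Reach p Y N T → T ⊆ p
reach-mins-⊆ first          = ⊆-refl
reach-mins-⊆ (lrMin r _)    = refl ∷ reach-mins-⊆ r
reach-mins-⊆ (nonMin r _ _) = _ ∷ʳ reach-mins-⊆ r

reach-mins-sorted : ∀ {p Y N T} → Reach p Y N T → Sorted T
reach-mins-sorted first          = [] ∷ []
reach-mins-sorted (lrMin r z<t)  = sorted-∷ z<t (reach-mins-sorted r)
reach-mins-sorted (nonMin r _ _) = reach-mins-sorted r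

reach-least : ∀ {p Y N t T} → Reach p Y N (t ∷ T) → All (t ≤_) p
reach-least first            = ≤-refl ∷ []
reach-least (lrMin r z<t)    = ≤-refl ∷ All.map (≤-trans (<⇒≤ z<t)) (reach-least r)
reach-least (nonMin r t<z _) = <⇒≤ t<z ∷ reach-least r

reach-nonMins-large : ∀ {p Y N t T} → Reach p Y N (t ∷ T) → All (t <_) (Y ++ N)
reach-nonMins-large first            = []
reach-nonMins-large (lrMin r z<t)    = All.map (<-trans z<t) (reach-nonMins-large r)
reach-nonMins-large (nonMin r t<z _) = t<z ∷ reach-nonMins-large r

reach-∈ : ∀ {p Y N T v} → Reach p Y N T → v ∈ p → v ∈ Y ++ N ⊎ v ∈ T
reach-∈ first            v∈        = inj₂ v∈
reach-∈ (lrMin r _)      (here eq) = inj₂ (here eq)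
reach-∈ (lrMin r _)      (there v∈) with reach-∈ r v∈
... | inj₁ v∈N = inj₁ v∈N
... | inj₂ v∈T = inj₂ (there v∈T)
reach-∈ (nonMin r _ _)   (here eq) = inj₁ (here eq)
reach-∈ (nonMin r _ _)   (there v∈) with reach-∈ r v∈
... | inj₁ v∈N = inj₁ (there v∈N)
... | inj₂ v∈T = inj₂ v∈T

-- The witness is the left-to-right minimum that was current when `m` was read.
nonMin⇒smaller-before : ∀ {p Y N T m} → Reach p Y N T → m ∈ Y ++ N → ∃ λ a → a < m × m ∷ a ∷ [] ⊆ p
nonMin⇒smaller-before (lrMin r _) m∈ with a , a<m , τ ← nonMin⇒smaller-before r m∈ = a , a<m , _ ∷ʳ τ
nonMin⇒smaller-before (nonMin r t<z _) (here refl) =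
  _ , t<z , refl ∷ from∈ (Any-resp-⊆ (reach-mins-⊆ r) (here refl))
nonMin⇒smaller-before (nonMin r _ _) (there m∈)
  with a , a<m , τ ← nonMin⇒smaller-before r m∈ = a , a<m , _ ∷ʳ τ

smaller-before⇒nonMin : ∀ {p Y N T a b} → Reach p Y N T → b ∷ a ∷ [] ⊆ p → a < b → b ∈ Y ++ N
smaller-before⇒nonMin first (_ ∷ʳ ()) _
smaller-before⇒nonMin first (_ ∷ ()) _
smaller-before⇒nonMin (lrMin r _) (_ ∷ʳ τ) a<b = smaller-before⇒nonMin r τ a<b
smaller-before⇒nonMin (lrMin r z<t) (refl ∷ τ) a<z =
  ⊥-elim (<⇒≱ (<-trans a<z z<t) (All.lookup (reach-least r) (to∈ τ)))
smaller-before⇒nonMin (nonMin r _ _) (_ ∷ʳ τ) a<b = there (smaller-before⇒nonMin r τ a<b)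
smaller-before⇒nonMin (nonMin r _ _) (refl ∷ _) _ = here refl

-- Goes back to the state just after `z` was read, so that its last constructors tell how `z` and
-- its predecessor were treated.
reach-suffix : ∀ inp {z p Y N T} → Reach (inp ʳ++ (z ∷ p)) Y N T →
               ∃₂ λ Y′ N′ → ∃ λ T′ → Reach (z ∷ p) Y′ N′ T′
reach-suffix []        r = _ , _ , _ , r
reach-suffix (w ∷ inp) r with reach-suffix inp r
... | _ , _ , _ , lrMin r′ _    = _ , _ , _ , r′
... | _ , _ , _ , nonMin r′ _ _ = _ , _ , _ , r′

-- The two outcomes of the first pass

Regular : Word → Word → Set
Regular r out = ∃₂ λ Y N → ∃₂ λ t T → Reach r Y N (t ∷ T) × out ≡ (Y ++ N) ʳ++ (t ∷ T)

-- `Reach p` describes the run up to this moment, so this is the first time that two entries lie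
-- above the minima.
DoublePush : Word → Set
DoublePush r = ∃ λ inp → ∃₂ λ z p → ∃₂ λ y N → ∃₂ λ t T →
  r ≡ inp ʳ++ (z ∷ p) × Reach p (y ∷ []) N (t ∷ T) × t < z × ¬ Blocked z y (t ∷ T)

Irregular : Word → Word → Set
Irregular r out = DoublePush r ×
  ∃ λ M → ∃₂ λ t T → out ≡ M ʳ++ (t ∷ T) × All (t <_) M × ¬ Sorted M

Outcome : Word → Word → Set
Outcome r out = Regular r out ⊎ Irregular r out

run-push-mins : ∀ {p Y N t T} → Reach p Y N (t ∷ T) → ∀ z inp →
                run Patterns (z ∷ inp) (t ∷ T) ≡ run Patterns inp (z ∷ t ∷ T)
run-push-mins r z inp = run-push Patterns inp (push-on-sorted z (reach-mins-sorted r))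

run-blocked : ∀ {p y N t T} → Reach p (y ∷ []) N (t ∷ T) → ∀ z inp → Blocked z y (t ∷ T) →
              run Patterns (z ∷ inp) (y ∷ t ∷ T) ≡ y ∷ run Patterns inp (z ∷ t ∷ T)
run-blocked {y = y} r z inp bl = trans
  (run-pop Patterns inp (no-push-blocked (All.head (reach-nonMins-large r)) bl))
  (cong (y ∷_) (run-push-mins r z inp))

-- Follows the run entry by entry. `Reach` persists while each pending entry is popped before the
-- next push; at the first double push `spill` takes over.
trace : ∀ inp {p Y N t T} → Unique (inp ʳ++ p) → Reach p Y N (t ∷ T) →
        Outcome (inp ʳ++ p) (N ʳ++ run Patterns inp (Y ++ t ∷ T))
trace [] _ r with reach-pending r
... | inj₁ refl       = inj₁ (_ , _ , _ , _ , r , refl)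
... | inj₂ (_ , refl) = inj₁ (_ , _ , _ , _ , r , refl)
trace (z ∷ inp) {p} {_} {N} {t} {T} u r
  with reach-pending r | ≢⇒<⊎> (head-≢ inp u (Any-resp-⊆ (reach-mins-⊆ r) (here refl)))
... | inj₁ refl | inj₁ z<t =
  subst (λ o → Outcome (inp ʳ++ (z ∷ p)) (N ʳ++ o)) (sym (run-push-mins r z inp))
    (trace inp u (lrMin r z<t))
... | inj₁ refl | inj₂ t<z =
  subst (λ o → Outcome (inp ʳ++ (z ∷ p)) (N ʳ++ o)) (sym (run-push-mins r z inp))
    (trace inp u (nonMin r t<z []))
... | inj₂ (y , refl) | inj₁ z<t =
  -- A new minimum is always blocked by a pending `y`, with `t` strictly between them.
  subst (λ o → Outcome (inp ʳ++ (z ∷ p)) (N ʳ++ o))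
    (sym (run-blocked r z inp (inj₂ (here (z<t , All.head (reach-nonMins-large r))))))
    (trace inp u (lrMin r z<t))
... | inj₂ (y , refl) | inj₂ t<z with blocked? z y (t ∷ T)
...   | yes bl =
  subst (λ o → Outcome (inp ʳ++ (z ∷ p)) (N ʳ++ o)) (sym (run-blocked r z inp bl))
    (trace inp u (nonMin r t<z (bl ∷ [])))
...   | no ¬bl =
  subst (λ o → Outcome (inp ʳ++ (z ∷ p)) (N ʳ++ o))
    (sym (run-push Patterns inp (push-unblocked (reach-mins-sorted r) ¬bl)))
    (inj₂ ((inp , z , p , y , N , t , T , refl , r , t<z , ¬bl) , spilled))
  where
  -- A pending entry is the last one read.
  y∈p : y ∈ p
  y∈p = case r of λ { (nonMin _ _ _) → here refl }

  spilled : ∃ λ M → ∃₂ λ t′ T′ →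
    N ʳ++ run Patterns inp (z ∷ y ∷ t ∷ T) ≡ M ʳ++ (t′ ∷ T′) × All (t′ <_) M × ¬ Sorted M
  spilled with t<y ∷ t<N ← reach-nonMins-large r
    with M , t′ , T′ , eq , t′<M , L⊆M ←
      spill inp (z ∷ y ∷ []) N t T
        (AllPairs-resp-⊆ (ʳ++⁺ {as = inp} ⊆-refl (z ∷ʳ reach-mins-⊆ r)) u)
        (reach-mins-sorted r) (t<z ∷ t<y ∷ []) t<N =
    M , t′ , T′ , eq , t′<M ,
    -- As `z` leaves before `y`, the list `M` has `y` ahead of `z`; sortedness would give `y ≤ z`,
    -- hence `y < z`, and the push would have been blocked.
    λ M↗ → ¬bl (inj₁ (≤∧≢⇒< (ascending M↗ (⊆-trans (refl ∷ refl ∷ minimum N) L⊆M))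
                            (head-≢ inp u y∈p ∘ sym)))

-- The patterns 123 and 132⋆, read from right to left

No321 : Word → Set
No321 r = ∀ {a b c} → c ∷ b ∷ a ∷ [] ⊆ r → a < b → b < c → ⊥

avoids-123⇒ : ∀ {x} → Avoids 123ₚ x → No321 (reverse x)
avoids-123⇒ {x} av τ a<b b<c =
  av (contains-123⁺ (subst (_ ⊆_) (reverse-involutive x) (reverse⁺ τ)) a<b b<c)

avoids-123⇐ : ∀ {x} → No321 (reverse x) → Avoids 123ₚ x
avoids-123⇐ ¬321 c with _ , _ , _ , τ , a<b , b<c ← contains-123⁻ c = ¬321 (reverse⁺ τ) a<b b<c

-- The pattern 132⋆ reversed and written as a splitting of the list, so that `suc z ∷ p` is a stage
-- of the run.
Contains23⋆1 : Word → Set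
Contains23⋆1 r = ∃ λ inp → ∃₂ λ z p → r ≡ inp ʳ++ (z ∷ suc z ∷ p) × Any (_< z) p

split-adjacent : ∀ (x : Word) (b c : Fin (length x)) → toℕ c ≡ suc (toℕ b) →
                 ∃₂ λ u w → x ≡ u ++ lookup x b ∷ lookup x c ∷ w ×
                            (∀ a → a Fin.< b → lookup x a ∈ u)
split-adjacent (y ∷ z ∷ w) zero (suc zero) _ = [] , w , refl , λ _ ()
split-adjacent (h ∷ x) (suc b) (suc c) eq
  with u , w , x≡ , before ← split-adjacent x b c (suc-injective eq) =
  h ∷ u , w , cong (h ∷_) x≡ , λ where
    zero    _         → here refl
    (suc a) (s<s a<b) → there (before a a<b)

contains-132⋆⇒ : ∀ {x} → Contains132⋆ x → Contains23⋆1 (reverse x)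
contains-132⋆⇒ {x} (a , b , c , a<b , c≡ , xa<xc , xb≡) with u , w , x≡ , before ← split-adjacent x b c c≡ =
  w , lookup x c , reverse u ,
  trans (cong reverse (trans x≡ (cong (λ y → u ++ y ∷ lookup x c ∷ w) xb≡))) (++-ʳ++ u) ,
  Any.map (λ { refl → xa<xc }) (∈-resp-↭ (↭-sym (↭-reverse u)) (before a a<b))

contains-132⋆-++ : ∀ {z} u w → Any (_< z) u → Contains132⋆ (u ++ suc z ∷ z ∷ w)
contains-132⋆-++ {z} (h ∷ u) w (here h<z) = zero , suc (at u) , suc (next u) , z<s , cong suc (next≡ u) ,
    subst (h <_) (sym (lookup-next u)) h<z , trans (lookup-at u) (cong suc (sym (lookup-next u)))
  where
  at next : ∀ u → Fin (length (u ++ suc z ∷ z ∷ w))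
  at []      = zero
  at (_ ∷ u) = suc (at u)
  next []      = suc zero
  next (_ ∷ u) = suc (next u)

  next≡ : ∀ u → toℕ (next u) ≡ suc (toℕ (at u))
  next≡ []      = refl
  next≡ (_ ∷ u) = cong suc (next≡ u)

  lookup-at : ∀ u → lookup (u ++ suc z ∷ z ∷ w) (at u) ≡ suc z
  lookup-at []      = refl
  lookup-at (_ ∷ u) = lookup-at u

  lookup-next : ∀ u → lookup (u ++ suc z ∷ z ∷ w) (next u) ≡ z
  lookup-next []      = refl
  lookup-next (_ ∷ u) = lookup-next u
contains-132⋆-++ (h ∷ u) w (there any) with a , b , c , a<b , c≡ , rest ← contains-132⋆-++ u w any =
  suc a , suc b , suc c , s<s a<b , cong suc c≡ , rest

contains-132⋆⇐ : ∀ {x} → Contains23⋆1 (reverse x) → Contains132⋆ x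
contains-132⋆⇐ {x} (inp , z , p , eq , any) = subst Contains132⋆ (sym x≡)
  (contains-132⋆-++ (reverse p) (inp ++ []) (Any-resp-↭ (↭-sym (↭-reverse p)) any))
  where
  x≡ : x ≡ reverse p ++ suc z ∷ z ∷ inp ++ []
  x≡ = trans (sym (reverse-involutive x)) (trans (cong reverse eq)
         (trans (ʳ++-ʳ++ inp) (ʳ++-defn p)))

-- Both patterns in terms of the run

-- The two larger entries of an increasing triple are both non-minima, and the later one exceeds the
-- earlier, against the order of `Y ++ N`.
reach⇒no321 : ∀ {r Y N T} → Reach r Y N T → Sorted (Y ++ N) → No321 r
reach⇒no321 first _ (_ ∷ʳ ()) _ _
reach⇒no321 first _ (_ ∷ ()) _ _
reach⇒no321 (lrMin r _)    M↗       (_ ∷ʳ τ)   a<b b<c = reach⇒no321 r M↗ τ a<b b<c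
reach⇒no321 (lrMin r z<t)  M↗       (refl ∷ τ) a<b b<z =
  <⇒≱ (<-trans b<z z<t) (All.lookup (reach-least r) (Any-resp-⊆ τ (here refl)))
reach⇒no321 (nonMin r _ _) (_ ∷ M↗) (_ ∷ʳ τ)   a<b b<c = reach⇒no321 r M↗ τ a<b b<c
reach⇒no321 (nonMin r _ _) (z≤ ∷ _) (refl ∷ τ) a<b b<z =
  <⇒≱ b<z (All.lookup z≤ (smaller-before⇒nonMin r τ a<b))

-- A non-minimum `m` read before a larger `z` extends to an increasing triple by a smaller entry
-- before `m`.
no321⇒sorted : ∀ {r Y N T} → Reach r Y N T → No321 r → Sorted (Y ++ N)
no321⇒sorted first          _  = []
no321⇒sorted (lrMin r _) ¬321 = no321⇒sorted r (¬321 ∘ (_ ∷ʳ_))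
no321⇒sorted (nonMin r _ _) ¬321 =
  All.tabulate (λ m∈ → ≮⇒≥ λ m<z →
    let _ , a<m , τ = nonMin⇒smaller-before r m∈ in ¬321 (refl ∷ τ) a<m m<z) ∷
  no321⇒sorted r (¬321 ∘ (_ ∷ʳ_))

-- The smaller entry before them keeps `z` and `suc z` from being minima. So `suc z` is pending when
-- `z` arrives and must be blocked, but `suc z < z` fails and no value lies strictly between.
reach⇒no23⋆1 : ∀ {r Y N T} → Reach r Y N T → ¬ Contains23⋆1 r
reach⇒no23⋆1 r (inp , z , p , refl , any) with a , a∈p , a<z ← find any with reach-suffix inp r
... | _ , _ , _ , lrMin r′ z<t =
  <⇒≱ (<-trans a<z z<t) (All.lookup (reach-least r′) (there a∈p))
... | _ , _ , _ , nonMin (lrMin r″ 1+z<t) _ _ =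
  <⇒≱ (<-trans a<z (<-trans ≤-refl 1+z<t)) (All.lookup (reach-least r″) a∈p)
... | _ , _ , _ , nonMin (nonMin _ _ _) _ (inj₁ 1+z<z ∷ []) = <-asym 1+z<z ≤-refl
... | _ , _ , _ , nonMin (nonMin _ _ _) _ (inj₂ between ∷ [])
  with _ , _ , z<v , v<1+z ← find between = <⇒≱ z<v (≤-pred v<1+z)

-- The entry z + 1 must be y itself: it is not a minimum, and as any other entry before or
-- after y and z it would be the middle or the last entry of an increasing triple.
doublePush⇒23⋆1 : ∀ {n r} → S n r → No321 r → DoublePush r → Contains23⋆1 r
doublePush⇒23⋆1 {n} r↭ ¬321 (inp , z , _ , y , N , t , T , refl , nonMin {p = p} r t<y _ , t<z , ¬bl)
  with suc z ≟ y
... | yes refl = inp , z , p , refl , Any-resp-⊆ (reach-mins-⊆ r) (here t<z)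
... | no 1+z≢y = ⊥-elim (located (∈-++⁻ inp (∈-resp-↭ (↭-sym (++↭ʳ++ inp (z ∷ y ∷ p))) 1+z∈r)))
  where
  1+z<y : suc z < y
  1+z<y = ≤∧≢⇒< (≤∧≢⇒< (≮⇒≥ (¬bl ∘ inj₁)) (head-≢ inp (permutation-unique r↭) (here refl))) 1+z≢y

  1+z∈r : suc z ∈ inp ʳ++ (z ∷ y ∷ p)
  -- The value `suc z` is below the entry `y`, so it is in the range of the permutation and occurs.
  1+z∈r with i , i<n , refl ← ∈-applyUpTo⁻ suc {n = n} (∈-resp-↭ r↭ (Any-resp-⊆ (⊆-ʳ++ inp) (there (here refl)))) =
    ∈-resp-↭ (↭-sym r↭) (∈-applyUpTo⁺ suc (<-trans (≤-pred 1+z<y) i<n))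

  located : suc z ∈ inp ⊎ suc z ∈ z ∷ y ∷ p → ⊥
  located (inj₁ ∈inp) = ¬321 (ʳ++⁺ (from∈ ∈inp) (refl ∷ y ∷ʳ ⊆-trans (refl ∷ minimum T) (reach-mins-⊆ r))) t<z ≤-refl
  located (inj₂ (here eq)) = 1+n≢n eq
  located (inj₂ (there (here eq))) = 1+z≢y eq
  located (inj₂ (there (there ∈p))) with reach-∈ r ∈p
  ... | inj₂ ∈T = ¬bl (inj₂ (Any.map (λ { refl → ≤-refl , 1+z<y }) ∈T))
  ... | inj₁ ∈N with _ , a<1+z , τ ← nonMin⇒smaller-before r ∈N =
    ¬321 (⊆-trans (z ∷ʳ refl ∷ τ) (⊆-ʳ++ inp)) a<1+z 1+z<y

-- The two inclusions

sort⇒av : ∀ n {x} → Sort n 132ₚ 321ₚ x → Av[123,132⋆] n x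
sort⇒av n {[]}    (x∈S , _) = x∈S , (λ { ([] , [] , () , _) }) , (λ { (() , _) })
-- The first entry is pushed onto the empty stack, which is the state `first`; the empty word has no
-- such state.
sort⇒av n {z ∷ x} (x∈S , s≡id)
  with trace x (permutation-unique (reverse-∈S x∈S)) first
     | subst Sorted (sym s≡id) (identity-sorted n)
... | inj₁ (Y , N , t , T , r , eq) | out↗ =
  x∈S ,
  avoids-123⇐ (reach⇒no321 r
    (west-sorts⁻ (Y ++ N) (reach-nonMins-large r) (subst (Sorted ∘ s) eq out↗))) ,
  reach⇒no23⋆1 r ∘ contains-132⋆⇒
... | inj₂ (_ , M , t , T , eq , t<M , ¬M↗) | out↗ =
  ⊥-elim (¬M↗ (west-sorts⁻ M t<M (subst (Sorted ∘ s) eq out↗)))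

av⇒sorted : ∀ n {x} → Av[123,132⋆] n x → Sorted (s (s[ 132ₚ , 321ₚ ] x))
av⇒sorted n {[]}    _ = []
av⇒sorted n {z ∷ x} (x∈S , av123 , av132⋆)
  with trace x (permutation-unique (reverse-∈S x∈S)) first
... | inj₁ (Y , N , t , T , r , eq) =
  subst (Sorted ∘ s) (sym eq)
    (west-sorts (Y ++ N) (t ∷ T) (no321⇒sorted r (avoids-123⇒ av123)) (reach-mins-sorted r))
... | inj₂ (double , _) = ⊥-elim (av132⋆ (contains-132⋆⇐
        (doublePush⇒23⋆1 (reverse-∈S x∈S) (avoids-123⇒ av123) double)))

theorem3p7 : (n : ℕ) → Sort n 132ₚ 321ₚ ≐ Av[123,132⋆] n
theorem3p7 n = sort⇒av n , λ {x} av@(x∈S , _) →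
  -- Both passes only permute their input, so a sorted output is the identity.
  x∈S , sorted-↭⇒≡ (av⇒sorted n av) (identity-sorted n) (↭-trans (stackMap-↭ West _) (↭-trans (stackMap-↭ Patterns x) x∈S))
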